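{- Let $n\ge 1$ and let $H$ and $K$ be two unbiased Bush-type Hadamard matrices of order $4n^2$. Let $L$ be a $(1,-1)$-matrix such that $HK^t=2nL$. Then $L$ is a Bush-type Hadamard matrix.
   Context: $J_k$ denotes the all-ones matrix of order $k$. A Hadamard matrix of order $k$ is a $k\times k$ matrix with entries in $\{ -1,1\}$ and pairwise orthogonal rows. Two Hadamard matrices $H,K$ of order $k$ are unbiased if $HK^t=\sqrt{k}\,L$ for some Hadamard matrix $L$. A Bush-type Hadamard matrix of order $4n^2$ is a Hadamard matrix $H=[H_{ij}]_{1\le i,j\le 2n}$ of order $4n^2$, partitioned into $2n\times 2n$ blocks $H_{ij}$, such that $H_{ii}=J_{2n}$ for all $i$ and $H_{ij}J_{2n}=J_{2n}H_{ij}=0$ for all $i\neq j$. -}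

module Defs where

open import Algebra.Properties.Semiring.Sum using (sum)
open import Data.Fin using (Fin; combine)
open import Data.Integer using (ℤ; +_; 0ℤ; 1ℤ; -1ℤ; _*_)
open import Data.Integer.Properties using (+-*-semiring)
open import Data.Nat as ℕ using (ℕ)
open import Data.Product using (Σ-syntax; _×_)
open import Data.Sum using (_⊎_)
open import Data.Vec.Functional using (Vector)
open import Relation.Binary.PropositionalEquality using (_≡_; _≢_)

Matrix : ℕ → ℕ → Set
Matrix m n = Fin m → Fin n → ℤ

Square : ℕ → Set
Square k = Matrix k k

private
  variable
    l m n : ℕ

infix 4 _≈_
infixl 7 _·_
infixr 8 _•_
infix 9 _ᵗ

-- Entrywise, since function extensionality is not available.
_≈_ : Matrix m n → Matrix m n → Set
A ≈ B = ∀ i j → A i j ≡ B i j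

_·_ : Matrix l m → Matrix m n → Matrix l n
(A · B) i j = sum +-*-semiring (λ k → A i k * B k j)

_ᵗ : Matrix m n → Matrix n m
(A ᵗ) i j = A j i

_•_ : ℤ → Matrix m n → Matrix m n
(c • A) i j = c * A i j

O : Matrix m n
O _ _ = 0ℤ

J : ∀ k → Square k
J _ _ _ = 1ℤ

innerProduct : Vector ℤ n → Vector ℤ n → ℤ
innerProduct u v = sum +-*-semiring (λ k → u k * v k)

IsSignMatrix : Matrix m n → Set
IsSignMatrix A = ∀ i j → A i j ≡ 1ℤ ⊎ A i j ≡ -1ℤ

record IsHadamard {k : ℕ} (H : Square k) : Set where
  field
    entries    : IsSignMatrix H
    orthogonal : ∀ i j → i ≢ j → innerProduct (H i) (H j) ≡ 0ℤ

-- √k is the natural number s with s² = k.  Nothing is lost when k is not a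
-- perfect square: H · K ᵗ has integer entries, while those of √k L would be
-- ±√k, hence irrational, so no such pair is unbiased.
record Unbiased {k : ℕ} (H K : Square k) : Set where
  field
    hadamardˡ : IsHadamard H
    hadamardʳ : IsHadamard K
    product   : Σ[ s ∈ ℕ ] Σ[ L ∈ Square k ]
                  (s ℕ.* s ≡ k) × IsHadamard L × (H · K ᵗ ≈ (+ s) • L)

-- combine i a is the index i * b + a, so that block A i j is the (i , j) block
-- of the partition of A into consecutive b × b blocks.
block : ∀ {m b} → Square (m ℕ.* b) → Fin m → Fin m → Square b
block A i j a c = A (combine i a) (combine j c)

-- The order 4n² is written (2n)(2n), exhibiting the 2n × 2n array of blocks.
bushOrder : ℕ → ℕ
bushOrder n = (2 ℕ.* n) ℕ.* (2 ℕ.* n)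

record IsBushType (n : ℕ) (H : Square (bushOrder n)) : Set where
  field
    hadamard  : IsHadamard H
    diagonal  : ∀ i → block {2 ℕ.* n} H i i ≈ J (2 ℕ.* n)
    offDiagʳ  : ∀ i j → i ≢ j → block {2 ℕ.* n} H i j · J (2 ℕ.* n) ≈ O
    offDiagˡ  : ∀ i j → i ≢ j → J (2 ℕ.* n) · block {2 ℕ.* n} H i j ≈ O

{-# OPTIONS --safe #-}
-- Summing H Kᵗ = 2n L over the columns of a block column replaces K by the
-- column sums of its blocks.  These are 2n on the diagonal and 0 elsewhere, so
-- the blocks of L have the same row sums as those of H; transposing, the column
-- sums of the blocks of L are the row sums of those of K.  A row of ±1 entries
-- with the same sum as a row of ones consists of ones, which gives the diagonal
-- blocks.  Since √(4n²) = 2n, L is the Hadamard matrix witnessing unbiasedness.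
module Submission where

open import Defs
import Algebra.Properties.Semiring.Sum as Sum
open import Data.Fin using (Fin; zero; suc; combine; punchIn; _↑ˡ_; _↑ʳ_)
open import Data.Fin.Properties using (punchInᵢ≢i)
open import Data.Nat using (ℕ; _≤_) renaming (_*_ to _*ℕ_)
open import Data.Nat as ℕ using (zero; suc)
open import Data.Nat.Properties as ℕ using (*-mono-<; <-cmp)
open import Data.Integer using (+_)
open import Data.Integer as ℤ using (ℤ; 0ℤ; 1ℤ; -1ℤ; _+_; _*_; NonZero; -≤+)
open import Data.Integer.Properties using (+-*-semiring; +-identityˡ; +-identityʳ; +-assoc; +-mono-≤; ≤∧≢⇒<; *-comm; *-zeroʳ; *-identityˡ; *-identityʳ; *-cancelˡ-≡)
import Data.Integer.Properties as ℤ
open import Data.Product using (_,_)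
open import Data.Sum using (_⊎_; inj₁; inj₂; map)
open import Data.Vec.Functional using (Vector)
open import Function using (_∘_)
open import Relation.Binary.Definitions using (tri<; tri≈; tri>)
open import Relation.Binary.PropositionalEquality using (_≡_; _≢_; refl; sym; trans; cong; cong₂; subst; ≢-sym; module ≡-Reasoning)
open import Relation.Nullary using (yes; no; contradiction)

open Sum +-*-semiring using (sum; sum-cong-≗; sum-remove; sum-replicate-zero; ∑-comm; *-distribˡ-sum)

private
  variable
    m n b : ℕ

-- Squaring is strictly increasing. This pins the root of the order `bushOrder n` in `Unbiased` to
-- 2n.
m*m≡n*n⇒m≡n : ∀ m n → m *ℕ m ≡ n *ℕ n → m ≡ n
m*m≡n*n⇒m≡n m n eq with <-cmp m n
... | tri< m<n _ _ = contradiction eq (ℕ.<⇒≢ (*-mono-< m<n m<n))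
... | tri≈ _ m≡n _ = m≡n
... | tri> _ _ n<m = contradiction (sym eq) (ℕ.<⇒≢ (*-mono-< n<m n<m))

sum-zero : (f : Vector ℤ n) → (∀ i → f i ≡ 0ℤ) → sum f ≡ 0ℤ
sum-zero {n} f f≡0 = trans (sum-cong-≗ f≡0) (sum-replicate-zero n)

sum-ones : (f : Vector ℤ n) → (∀ i → f i ≡ 1ℤ) → sum f ≡ + n
sum-ones {zero}  f f≡1 = refl
sum-ones {suc n} f f≡1 = cong₂ _+_ (f≡1 zero) (sum-ones (f ∘ suc) (f≡1 ∘ suc))

sum-single : (f : Vector ℤ n) (j : Fin n) → (∀ i → i ≢ j → f i ≡ 0ℤ) → sum f ≡ f j
sum-single {suc n} f j f≡0 = begin
  sum f                          ≡⟨ sum-remove {i = j} f ⟩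
  f j + sum (f ∘ punchIn j)      ≡⟨ cong (_+_ (f j)) (sum-zero (f ∘ punchIn j) λ i → f≡0 (punchIn j i) (punchInᵢ≢i j i)) ⟩
  f j + 0ℤ                       ≡⟨ +-identityʳ (f j) ⟩
  f j                            ∎
  where open ≡-Reasoning

sum-splitAt : ∀ m (f : Vector ℤ (m ℕ.+ n)) →
  sum f ≡ sum (λ i → f (i ↑ˡ n)) + sum (λ i → f (m ↑ʳ i))
sum-splitAt zero    f = sym (+-identityˡ (sum f))
sum-splitAt (suc m) f =
  trans (cong (_+_ (f zero)) (sum-splitAt m (f ∘ suc))) (sym (+-assoc (f zero) _ _))

-- `combine` unfolds to `↑ˡ` on the first block and to `↑ʳ` on the others, so each `sum-splitAt`
-- peels off one block.
sum-combine : ∀ m b (f : Vector ℤ (m *ℕ b)) →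
  sum f ≡ sum (λ (i : Fin m) → sum (λ (a : Fin b) → f (combine i a)))
sum-combine zero    b f = refl
sum-combine (suc m) b f =
  trans (sum-splitAt b f) (cong (_+_ (sum (λ a → f (a ↑ˡ (m *ℕ b))))) (sum-combine m b (f ∘ (b ↑ʳ_))))

sum-mono-≤ : (f g : Vector ℤ n) → (∀ i → f i ℤ.≤ g i) → sum f ℤ.≤ sum g
sum-mono-≤ {zero}  f g f≤g = ℤ.≤-refl
sum-mono-≤ {suc n} f g f≤g = +-mono-≤ (f≤g zero) (sum-mono-≤ (f ∘ suc) (g ∘ suc) (f≤g ∘ suc))

-- A strict gap at one index cannot be made up at the others, where `f` stays below `g`.
sum-≤-≡⇒≗ : (f g : Vector ℤ n) → (∀ i → f i ℤ.≤ g i) → sum f ≡ sum g → ∀ i → f i ≡ g i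
sum-≤-≡⇒≗ {suc n} f g f≤g eq i with f i ℤ.≟ g i
... | yes fi≡gi = fi≡gi
... | no  fi≢gi = contradiction eq (ℤ.<⇒≢ sum-f<sum-g)
  where
  open ℤ.≤-Reasoning
  sum-f<sum-g : sum f ℤ.< sum g
  sum-f<sum-g = begin-strict
    sum f                      ≡⟨ sum-remove {i = i} f ⟩
    f i + sum (f ∘ punchIn i)  <⟨ ℤ.+-mono-<-≤ (≤∧≢⇒< (f≤g i) fi≢gi) (sum-mono-≤ _ _ (f≤g ∘ punchIn i)) ⟩
    g i + sum (g ∘ punchIn i)  ≡⟨ sum-remove {i = i} g ⟨
    sum g                      ∎

sign≤1 : ∀ {x} → x ≡ 1ℤ ⊎ x ≡ -1ℤ → x ℤ.≤ 1ℤ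
sign≤1 (inj₁ refl) = ℤ.≤-refl
sign≤1 (inj₂ refl) = -≤+

·J-entry : (A : Square n) → ∀ i j → (A · J n) i j ≡ sum (A i)
·J-entry A i j = sum-cong-≗ (λ k → *-identityʳ (A i k))

J·-entry : (A : Square n) → ∀ i j → (J n · A) i j ≡ sum ((A ᵗ) j)
J·-entry A i j = sum-cong-≗ (λ k → *-identityˡ (A k j))

isHadamard-resp-≈ : {A B : Square n} → A ≈ B → IsHadamard A → IsHadamard B
isHadamard-resp-≈ A≈B hA = record
  { entries    = λ i j → map (trans (sym (A≈B i j))) (trans (sym (A≈B i j))) (entries i j)
  ; orthogonal = λ i j i≢j →
      trans (sum-cong-≗ λ k → sym (cong₂ _*_ (A≈B i k) (A≈B j k))) (orthogonal i j i≢j)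
  }
  where open IsHadamard hA

•-cancelˡ : ∀ c .{{_ : NonZero c}} {A B : Square n} → c • A ≈ c • B → A ≈ B
•-cancelˡ c eq i j = *-cancelˡ-≡ c _ _ (eq i j)

blockRowSum-product : ∀ c .{{_ : NonZero c}} (A B C : Square (m *ℕ b)) →
  A · B ᵗ ≈ c • C →
  (∀ j d → sum (λ a → block {m} B j j a d) ≡ c) →
  (∀ j l → j ≢ l → ∀ d → sum (λ a → block {m} B j l a d) ≡ 0ℤ) →
  ∀ i j a → sum (block {m} C i j a) ≡ sum (block {m} A i j a)
blockRowSum-product {m} {b} c A B C AB≈cC diag off i j a = *-cancelˡ-≡ c _ _ (begin
  c * sum (block {m} C i j a)
    ≡⟨ *-distribˡ-sum c (block {m} C i j a) ⟩
  sum (λ e → c * C p (combine j e))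
    ≡⟨ sum-cong-≗ (λ e → sym (AB≈cC p (combine j e))) ⟩
  sum (λ e → sum (λ k → A p k * B (combine j e) k))
    -- After the exchange the inner sum runs down a column within block row `j` of `B`.
    ≡⟨ ∑-comm (λ (e : Fin b) k → A p k * B (combine j e) k) ⟩
  sum (λ k → sum (λ e → A p k * B (combine j e) k))
    ≡⟨ sum-cong-≗ (λ k → sym (*-distribˡ-sum (A p k) (λ (e : Fin b) → B (combine j e) k))) ⟩
  sum (λ k → A p k * sum (λ (e : Fin b) → B (combine j e) k))
    ≡⟨ sum-combine m b _ ⟩
  sum (λ (l : Fin m) → sum (λ d → A p (combine l d) * sum (λ e → block {m} B j l e d)))
    -- Only block column `j` survives: the column sums of block `(j , l)` vanish for `l ≢ j`.
    ≡⟨ sum-single _ j (λ l l≢j → sum-zero _ λ d →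
         trans (cong (A p (combine l d) *_) (off j l (≢-sym l≢j) d)) (*-zeroʳ (A p (combine l d)))) ⟩
  sum (λ d → A p (combine j d) * sum (λ e → block {m} B j j e d))
    ≡⟨ sum-cong-≗ (λ d → trans (cong (A p (combine j d) *_) (diag j d)) (*-comm _ c)) ⟩
  sum (λ d → c * A p (combine j d))
    ≡⟨ *-distribˡ-sum c (block {m} A i j a) ⟨
  c * sum (block {m} A i j a) ∎)
  where
  open ≡-Reasoning
  p = combine i a

module BushType {H : Square (bushOrder n)} (bush : IsBushType n H) where
  open IsBushType bush

  rowSum-offDiag : ∀ i j → i ≢ j → ∀ a → sum (block {2 *ℕ n} H i j a) ≡ 0ℤ
  -- The columns of a product with `J` on the right coincide, so any column index serves; `a` is at
  -- hand.
  rowSum-offDiag i j i≢j a = trans (sym (·J-entry (block {2 *ℕ n} H i j) a a)) (offDiagʳ i j i≢j a a)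

  colSum-offDiag : ∀ i j → i ≢ j → ∀ d → sum (λ a → block {2 *ℕ n} H i j a d) ≡ 0ℤ
  colSum-offDiag i j i≢j d = trans (sym (J·-entry (block {2 *ℕ n} H i j) d d)) (offDiagˡ i j i≢j d d)

  colSum-diag : ∀ i d → sum (λ a → block {2 *ℕ n} H i i a d) ≡ + (2 *ℕ n)
  colSum-diag i d = sum-ones _ (λ a → diagonal i a d)

lemma3p2 : (n : ℕ) → 1 ≤ n →
    (H K : Square (bushOrder n)) →
    IsBushType n H → IsBushType n K → Unbiased H K →
    (L : Square (bushOrder n)) → IsSignMatrix L →
    H · K ᵗ ≈ (+ (2 *ℕ n)) • L →
    IsBushType n L
-- With `n` a successor, `+ (2 *ℕ n)` is visibly nonzero and can be cancelled.
lemma3p2 n@(suc _) 1≤n H K bushH bushK unbiased L signL HKᵗ≈2nL = record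
  { hadamard = hadamardL (Unbiased.product unbiased)
  ; diagonal = λ i a →
      let H≡1 = IsBushType.diagonal bushH i a in
      λ d → trans
        (sum-≤-≡⇒≗ _ _
          (λ e → subst (block {2n} L i i a e ℤ.≤_) (sym (H≡1 e)) (sign≤1 (signL _ _)))
          (rowSum i i a) d)
        (H≡1 d)
  ; offDiagʳ = λ i j i≢j a d →
      trans (·J-entry (block {2n} L i j) a d)
        (trans (rowSum i j a) (BushType.rowSum-offDiag {n} bushH i j i≢j a))
  ; offDiagˡ = λ i j i≢j a d →
      trans (J·-entry (block {2n} L i j) a d)
        -- Column `d` of block `(i , j)` of `L` is row `d` of block `(j , i)` of `L ᵗ`.
        (trans (colSum j i d) (BushType.rowSum-offDiag {n} bushK j i (≢-sym i≢j) d))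
  }
  where
  2n = 2 *ℕ n

  hadamardL : _ → IsHadamard L
  -- Once `s` is 2n, both `L′` and `L` scaled by 2n equal `H · K ᵗ`.
  hadamardL (s , L′ , s²≡k , hL′ , HKᵗ≈sL′) with refl ← m*m≡n*n⇒m≡n s 2n s²≡k =
    isHadamard-resp-≈ (•-cancelˡ (+ 2n) λ i j → trans (sym (HKᵗ≈sL′ i j)) (HKᵗ≈2nL i j)) hL′

  rowSum : ∀ i j a → sum (block {2n} L i j a) ≡ sum (block {2n} H i j a)
  rowSum = blockRowSum-product (+ 2n) H K L HKᵗ≈2nL
    (BushType.colSum-diag {n} bushK) (BushType.colSum-offDiag {n} bushK)

  colSum : ∀ j i d → sum (block {2n} (L ᵗ) j i d) ≡ sum (block {2n} K j i d)
  colSum = blockRowSum-product (+ 2n) K H (L ᵗ)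
    -- The transposed equation: `K · H ᵗ` is the transpose of `H · K ᵗ`.
    (λ p q → trans (sum-cong-≗ λ k → *-comm (K p k) (H q k)) (HKᵗ≈2nL q p))
    (BushType.colSum-diag {n} bushH) (BushType.colSum-offDiag {n} bushH)
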